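{- Let $n\ge k>a\ge 0$ be integers. If $n\geq k\left(\left\lceil\frac{k-a}{a+1}\right\rceil+2\right)$ and $k-2\ge a$, then $B(K(n,k,a))=\left\lceil\frac{k-a}{a+1}\right\rceil+2$.
   Context: All graphs are finite, undirected, without loops or multiple edges. In a zero forcing process, the vertices of a graph are initially colored black or white; whenever there is a black vertex adjacent to exactly one white vertex, that white vertex is forced to become black, and this is repeated as long as possible. An initial set of black vertices is a zero forcing set if eventually all vertices of the graph become black; otherwise it is a failed zero forcing set, and its complement (the initial set of white vertices) is called a zero blocking set. The zero blocking number $B(G)$ of $G$ is the minimum size of a zero blocking set of $G$. Let $[n]=\{1,2,\ldots,n\}$. For integers $n\ge k>a\ge 0$, the generalized Kneser graph $K(n,k,a)$ is the graph whose vertices are the $k$-subsets of $[n]$, where two (distinct) vertices $A$ and $B$ are adjacent if and only if $|A\cap B|\le a$. -}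

module Defs where

open import Data.Bool.Base using (Bool; not; T; true; false)
open import Data.Bool.Properties using (T?)
import Data.Bool.Properties as Bool
open import Data.Fin.Subset using (Subset; inside; outside; _∩_) renaming (∣_∣ to card)
open import Data.Fin.Subset.Properties using (∩-comm)
open import Data.Integer.Base using (+_; ∣_∣)
open import Data.List.Base using (List; []; _∷_; [_]; _++_; map; filter; length)
open import Data.List.Membership.Propositional using (_∈_)
open import Data.List.Membership.Propositional.Properties
  using (∈-map⁺; ∈-map⁻; ∈-++⁺ˡ; ∈-++⁺ʳ)
open import Data.List.Relation.Binary.Disjoint.Propositional using (Disjoint)
open import Data.List.Relation.Unary.All using ([])
open import Data.List.Relation.Unary.AllPairs using ([]; _∷_)
open import Data.List.Relation.Unary.Any using (here)
open import Data.List.Relation.Unary.Unique.Propositional using (Unique)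
import Data.List.Relation.Unary.Unique.Propositional.Properties as Unique
open import Data.Nat.Base using (ℕ; zero; suc; _≤_; NonZero)
import Data.Nat.Properties as ℕ
open import Data.Product.Base using (Σ-syntax; ∃-syntax; _×_; _,_; proj₁; proj₂)
import Data.Rational.Unnormalised.Base as ℚᵘ
open import Data.Sum.Base using (_⊎_)
open import Data.Vec.Base using ([]; _∷_)
import Data.Vec.Properties as Vec
open import Function.Base using (_∘_)
open import Function.Bundles using (_⇔_)
open import Relation.Binary.Construct.Closure.ReflexiveTransitive using (Star)
open import Relation.Binary.Definitions using (DecidableEquality; Decidable; Symmetric)
open import Relation.Binary.PropositionalEquality
  using (_≡_; _≢_; refl; sym; trans; cong; subst)
open import Relation.Nullary.Decidable using (map′; ¬?; _×-dec_)
open import Relation.Nullary.Negation using (¬_)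

-- The ceiling of a nonnegative rational is nonnegative, so ∣_∣ only
-- transports it from ℤ to ℕ.
⌈_/_⌉ : (m d : ℕ) → .{{NonZero d}} → ℕ
⌈ m / d ⌉ = ∣ ℚᵘ.ceiling ((+ m) ℚᵘ./ d) ∣

record Graph : Set₁ where
  field
    Vertex   : Set
    _≟_      : DecidableEquality Vertex
    vertices : List Vertex
    unique   : Unique vertices
    complete : ∀ v → v ∈ vertices
    Adj      : Vertex → Vertex → Set
    adj?     : Decidable Adj
    symm     : Symmetric Adj
    irrefl   : ∀ v → ¬ Adj v v

module ZeroForcing (G : Graph) where
  open Graph G

  VertexSet : Set
  VertexSet = Vertex → Bool

  infix 4 _∈ᵛ_ _∉ᵛ_ _⟶_

  _∈ᵛ_ _∉ᵛ_ : Vertex → VertexSet → Set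
  v ∈ᵛ S = T (S v)
  v ∉ᵛ S = ¬ (v ∈ᵛ S)

  ∁ : VertexSet → VertexSet
  ∁ S = not ∘ S

  size : VertexSet → ℕ
  size S = length (filter (T? ∘ S) vertices)

  -- A single force; Z and Z′ are the sets of black vertices before and after.
  record _⟶_ (Z Z′ : VertexSet) : Set where
    field
      u v       : Vertex
      u-black   : u ∈ᵛ Z
      v-white   : v ∉ᵛ Z
      u-adj-v   : Adj u v
      only-v    : ∀ w → Adj u w → w ∉ᵛ Z → w ≡ v
      recolour  : ∀ w → w ∈ᵛ Z′ ⇔ (w ∈ᵛ Z ⊎ w ≡ v)

  IsZeroForcingSet : VertexSet → Set
  IsZeroForcingSet Z = ∃[ Z′ ] Star _⟶_ Z Z′ × (∀ v → v ∈ᵛ Z′)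

  IsFailedZeroForcingSet : VertexSet → Set
  IsFailedZeroForcingSet Z = ¬ IsZeroForcingSet Z

  IsZeroBlockingSet : VertexSet → Set
  IsZeroBlockingSet W = IsFailedZeroForcingSet (∁ W)

  -- A relation rather than a function: the graph without vertices has no
  -- zero blocking set.
  IsZeroBlockingNumber : ℕ → Set
  IsZeroBlockingNumber b =
    (∃[ W ] IsZeroBlockingSet W × size W ≡ b) ×
    (∀ W → IsZeroBlockingSet W → b ≤ size W)

open ZeroForcing public using (IsZeroBlockingNumber)

KSubset : ℕ → ℕ → Set
KSubset n k = Σ[ A ∈ Subset n ] card A ≡ k

private
  variable
    n k : ℕ

KSubset-≡ : {A B : KSubset n k} → proj₁ A ≡ proj₁ B → A ≡ B
KSubset-≡ {A = A , p} {B = .A , q} refl = cong (A ,_) (ℕ.≡-irrelevant p q)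

_≟ᴷ_ : DecidableEquality (KSubset n k)
A ≟ᴷ B = map′ KSubset-≡ (cong proj₁) (Vec.≡-dec Bool._≟_ (proj₁ A) (proj₁ B))

with-first : KSubset n k → KSubset (suc n) (suc k)
with-first (A , p) = inside ∷ A , cong suc p

without-first : KSubset n k → KSubset (suc n) k
without-first (A , p) = outside ∷ A , p

with-first-injective : {A B : KSubset n k} → with-first A ≡ with-first B → A ≡ B
with-first-injective = KSubset-≡ ∘ Vec.∷-injectiveʳ ∘ cong proj₁

without-first-injective : {A B : KSubset n k} → without-first A ≡ without-first B → A ≡ B
without-first-injective = KSubset-≡ ∘ Vec.∷-injectiveʳ ∘ cong proj₁

kSubsets : ∀ n k → List (KSubset n k)
kSubsets zero    zero    = [ [] , refl ]
kSubsets zero    (suc k) = []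
kSubsets (suc n) zero    = map without-first (kSubsets n zero)
kSubsets (suc n) (suc k) =
  map with-first (kSubsets n k) ++ map without-first (kSubsets n (suc k))

kSubsets-unique : ∀ n k → Unique (kSubsets n k)
kSubsets-unique zero    zero    = [] ∷ []
kSubsets-unique zero    (suc k) = []
kSubsets-unique (suc n) zero    =
  Unique.map⁺ without-first-injective (kSubsets-unique n zero)
kSubsets-unique (suc n) (suc k) = Unique.++⁺
  (Unique.map⁺ with-first-injective (kSubsets-unique n k))
  (Unique.map⁺ without-first-injective (kSubsets-unique n (suc k)))
  disjoint
  where
  disjoint : Disjoint (map with-first (kSubsets n k))
                      (map without-first (kSubsets n (suc k)))
  disjoint (p , q) with ∈-map⁻ with-first p | ∈-map⁻ without-first q
  ... | _ , _ , eq | _ , _ , eq′ with cong proj₁ (trans (sym eq) eq′)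
  ... | ()

kSubsets-complete : ∀ n k (A : KSubset n k) → A ∈ kSubsets n k
kSubsets-complete zero    zero    ([] , p) = here (KSubset-≡ refl)
kSubsets-complete zero    (suc k) ([] , ())
kSubsets-complete (suc n) zero    (true ∷ A , ())
kSubsets-complete (suc n) zero    (false ∷ A , p) =
  ∈-map⁺ without-first (kSubsets-complete n zero (A , p))
kSubsets-complete (suc n) (suc k) (true ∷ A , p) =
  subst (_∈ kSubsets (suc n) (suc k)) (KSubset-≡ refl)
    (∈-++⁺ˡ (∈-map⁺ with-first (kSubsets-complete n k (A , ℕ.suc-injective p))))
kSubsets-complete (suc n) (suc k) (false ∷ A , p) =
  ∈-++⁺ʳ (map with-first (kSubsets n k))
    (∈-map⁺ without-first (kSubsets-complete n (suc k) (A , p)))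

K : (n k a : ℕ) → Graph
K n k a = record
  { Vertex   = KSubset n k
  ; _≟_      = _≟ᴷ_
  ; vertices = kSubsets n k
  ; unique   = kSubsets-unique n k
  ; complete = kSubsets-complete n k
  ; Adj      = λ A B → A ≢ B × card (proj₁ A ∩ proj₁ B) ≤ a
  ; adj?     = λ A B → ¬? (A ≟ᴷ B) ×-dec (card (proj₁ A ∩ proj₁ B) ℕ.≤? a)
  ; symm     = λ {A} {B} (A≢B , ∣A∩B∣≤a) →
                 A≢B ∘ sym ,
                 subst (λ C → card C ≤ a) (∩-comm (proj₁ A) (proj₁ B)) ∣A∩B∣≤a
  ; irrefl   = λ _ (A≢A , _) → A≢A refl
  }

{-# OPTIONS --safe #-}

-- Write s = ⌈(k − a)/(a + 1)⌉, so that s(a + 1) ≤ k < (s + 1)(a + 1).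
-- Since n ≥ k(s + 2), there are s + 2 pairwise disjoint k-sets, and they form a
-- zero blocking set: a vertex with exactly one neighbour among them would meet
-- the other s + 1 in at least (s + 1)(a + 1) > k points.
-- Conversely, at most s + 1 white vertices can always be forced, one at a time.
-- Given white k-sets p and q₁, …, q_l with l ≤ s, we want a black u with
-- |u ∩ p| ≤ a and |u ∩ qᵢ| > a for all i.  As l ≤ k − a, some (k − a)-subset of
-- p contains a point of p ∖ qᵢ for each i; its complement d satisfies
-- |p ∩ d| ≤ a and |qᵢ ∩ d| > a.  Choosing a + 1 points of each qᵢ ∩ d takes at
-- most s(a + 1) ≤ k points, and the missing ones are taken outside p.
module Submission where

open import Defs
open import Data.Nat.Base using (ℕ; suc; _+_; _*_; _∸_; _≤_; _<_; _≥_)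

open import Data.Bool.Base using (Bool; T; true; false; _∨_)
import Data.Bool.Properties as Bool
import Data.Fin.Base as Fin
open import Data.Fin.Subset
  using (Subset; inside; outside; ⊥; ⁅_⁆; ∁; _∩_; _∪_; ⋃; _⊆_; Nonempty)
  renaming (∣_∣ to card; _∈_ to _∈ˢ_; _∉_ to _∉ˢ_)
open import Data.Fin.Subset.Properties hiding (_∈?_)
open import Data.Fin.Subset.Properties using () renaming (_∈?_ to _∈ˢ?_)
import Data.Integer.Base as ℤ
import Data.Integer.Properties as ℤ
open import Data.List.Base using (List; []; _∷_; _++_; map; filter; length)
open import Data.List.Membership.Propositional using (_∈_; _∉_)
open import Data.List.Membership.Propositional.Properties
  using (∈-∃++; ∈-map⁺; ∈-filter⁺; ∈-filter⁻)
open import Data.List.Membership.Propositional.Properties.WithK using (unique∧set⇒bag)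
open import Data.List.Properties using (length-map)
open import Data.List.Relation.Binary.BagAndSetEquality using (∼bag⇒↭)
open import Data.List.Relation.Binary.Permutation.Propositional
  using (_↭_; ↭-sym; ↭-reflexive; ↭-trans; ↭⇒↭ₛ)
open import Data.List.Relation.Binary.Permutation.Propositional.Properties
  using (↭-length; All-resp-↭; ∈-resp-↭; shift)
import Data.List.Relation.Binary.Permutation.Setoid.Properties as ↭ₛ
open import Data.List.Relation.Unary.All as All using (All; []; _∷_)
import Data.List.Relation.Unary.All.Properties as All
open import Data.List.Relation.Unary.AllPairs as AllPairs using (AllPairs; []; _∷_)
import Data.List.Relation.Unary.AllPairs.Properties as AllPairs
open import Data.List.Relation.Unary.Any using (here; there; any?)
open import Data.List.Relation.Unary.Unique.Propositional using (Unique)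
import Data.List.Relation.Unary.Unique.Propositional.Properties as Unique
open import Data.Nat.Base using (zero; z≤n; s≤s; _⊓_; _%_; _/_)
open import Data.Nat.DivMod using (m≡m%n+[m/n]*n; m%n<n)
open import Data.Nat.Properties hiding (_≟_)
open import Data.Product.Base using (∃; ∃-syntax; _×_; _,_; proj₁; proj₂)
open import Data.Sum.Base as Sum using (_⊎_; inj₁; inj₂)
open import Data.Vec.Base as Vec using ([]; _∷_)
import Data.Vec.Properties as Vec
open import Function.Base using (_∘_; id)
open import Function.Bundles using (_⇔_; mk⇔; Equivalence)
open import Relation.Binary.Construct.Closure.ReflexiveTransitive using (ε; _◅_)
open import Relation.Binary.PropositionalEquality
  using (_≡_; _≢_; refl; sym; trans; cong; subst; resp₂; setoid)
open import Relation.Nullary.Decidable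
  using (yes; no; ⌊_⌋; toWitness; fromWitness; decidable-stable)
open import Relation.Nullary.Negation using (¬_; contradiction)

open Equivalence using (to; from)

private
  variable
    n k a : ℕ
    p q : Subset n

-- Bounds for the rounded-up quotient.

-- The ceiling unfolds to the negated floor of the negated fraction, and integer division of a
-- negative number splits on the remainder: with `Q` the quotient of the division with remainder by
-- `suc c`, the ceiling is `Q` if the remainder vanishes and `Q + 1` otherwise.
⌈/⌉-bounds : ∀ m c → m ≤ ⌈ m / suc c ⌉ * suc c × ⌈ m / suc c ⌉ * suc c ≤ m + c
⌈/⌉-bounds zero    c = z≤n , z≤n
⌈/⌉-bounds (suc m) c
  with suc m % suc c | m≡m%n+[m/n]*n (suc m) (suc c) | m%n<n (suc m) (suc c)
... | zero  | eq | _
  rewrite ℤ.*-identityˡ (ℤ.- (ℤ.+ (suc m / suc c)))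
        | ℤ.neg-involutive (ℤ.+ (suc m / suc c))
  = ≤-reflexive eq , ≤-trans (≤-reflexive (sym eq)) (m≤m+n (suc m) c)
... | suc r | eq | r<c
  rewrite +-identityʳ (suc m / suc c)
  = ≤-trans (≤-reflexive eq) (+-monoˡ-≤ _ (<⇒≤ r<c)) ,
    (begin
      suc c + Q * suc c     ≡⟨ cong suc (+-comm c _) ⟩
      suc (Q * suc c) + c   ≤⟨ +-monoˡ-≤ c (+-monoˡ-≤ (Q * suc c) (s≤s (z≤n {r}))) ⟩
      suc r + Q * suc c + c ≡⟨ cong (_+ c) eq ⟨
      suc m + c             ∎)
  where
  open ≤-Reasoning
  Q = suc m / suc c

-- Cardinalities, intermediate subsets and unions of finite sets.

card-split : ∀ (p q : Subset n) → card p ≡ card (p ∩ q) + card (p ∩ ∁ q)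
card-split []            []            = refl
card-split (outside ∷ p) (y ∷ q)       = card-split p q
card-split (inside ∷ p)  (inside ∷ q)  = cong suc (card-split p q)
card-split (inside ∷ p)  (outside ∷ q) =
  trans (cong suc (card-split p q)) (sym (+-suc _ _))

card-∪ : ∀ (p q : Subset n) → card (p ∪ q) ≤ card p + card q
card-∪ []            []            = z≤n
card-∪ (outside ∷ p) (outside ∷ q) = card-∪ p q
card-∪ (outside ∷ p) (inside ∷ q)  =
  ≤-trans (s≤s (card-∪ p q)) (≤-reflexive (sym (+-suc _ _)))
card-∪ (inside ∷ p)  (outside ∷ q) = s≤s (card-∪ p q)
card-∪ (inside ∷ p)  (inside ∷ q)  =
  s≤s (≤-trans (card-∪ p q) (+-monoʳ-≤ (card p) (n≤1+n (card q))))

⊆∧card≥⇒≡ : p ⊆ q → card q ≤ card p → p ≡ q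
⊆∧card≥⇒≡ {p = p} p⊆q ∣q∣≤∣p∣ = ⊆-antisym p⊆q λ {x} x∈q →
  decidable-stable (x ∈ˢ? p) λ x∉p →
    ≤⇒≯ ∣q∣≤∣p∣ (p⊂q⇒∣p∣<∣q∣ (p⊆q , x , x∈q , x∉p))

card>0⇒Nonempty : 0 < card p → Nonempty p
card>0⇒Nonempty {n} {p} 0<∣p∣ = decidable-stable (nonempty? p) λ empty →
  <⇒≢ 0<∣p∣ (sym (trans (cong card (Empty-unique empty)) (∣⊥∣≡0 n)))

⊈⇒∃ : ¬ (p ⊆ q) → ∃[ x ] x ∈ˢ p × x ∉ˢ q
⊈⇒∃ {p = p} {q} p⊈q with nonempty? (p ∩ ∁ q)
... | yes (x , x∈p∩∁q) with x∈p , x∈∁q ← x∈p∩q⁻ p (∁ q) x∈p∩∁q =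
  x , x∈p , x∈∁p⇒x∉p x∈∁q
... | no empty = contradiction
  (λ {x} x∈p → x∉∁p⇒x∈p λ x∈∁q → empty (x , x∈p∩q⁺ (x∈p , x∈∁q))) p⊈q

card<n⇒∃∉ : ∀ (p : Subset n) → card p < n → ∃ (_∉ˢ p)
card<n⇒∃∉ p ∣p∣<n
  with x , x∈∁p ← card>0⇒Nonempty {p = ∁ p}
                    (≤-trans (m<n⇒0<n∸m ∣p∣<n) (≤-reflexive (sym (∣∁p∣≡n∸∣p∣ p))))
  = x , x∈∁p⇒x∉p x∈∁p

-- This is the source of all sets of prescribed size below, both when a set is cut down and when it
-- is padded.
⊆-interpolate : ∀ (p q : Subset n) {j} → p ⊆ q → card p ≤ j → j ≤ card q →
                ∃[ r ] p ⊆ r × r ⊆ q × card r ≡ j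
⊆-interpolate [] [] p⊆q _ z≤n = [] , id , id , refl
⊆-interpolate (inside ∷ p) (outside ∷ q) p⊆q _ _
  with () ← p⊆q {Fin.zero} Vec.here
⊆-interpolate (inside ∷ p) (inside ∷ q) p⊆q (s≤s lo) (s≤s hi)
  with r , p⊆r , r⊆q , eq ← ⊆-interpolate p q (drop-∷-⊆ p⊆q) lo hi
  = inside ∷ r , s⊆s p⊆r , s⊆s r⊆q , cong suc eq
⊆-interpolate (outside ∷ p) (outside ∷ q) p⊆q lo hi
  with r , p⊆r , r⊆q , eq ← ⊆-interpolate p q (drop-∷-⊆ p⊆q) lo hi
  = outside ∷ r , s⊆s p⊆r , s⊆s r⊆q , eq
⊆-interpolate (outside ∷ p) (inside ∷ q) {j} p⊆q lo hi with j ≤? card q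
-- Here `j` exceeds the size of the tail, so it equals the size of the whole upper set, which is
-- taken itself.
... | no j≰∣q∣ = inside ∷ q , p⊆q , id , ≤-antisym (≰⇒> j≰∣q∣) hi
... | yes j≤∣q∣
  with r , p⊆r , r⊆q , eq ← ⊆-interpolate p q (drop-∷-⊆ p⊆q) lo j≤∣q∣
  = outside ∷ r , s⊆s p⊆r , out⊆ r⊆q , eq

private
  truncation : ∀ j (p : Subset n) → ∃[ r ] ⊥ ⊆ r × r ⊆ p × card r ≡ j ⊓ card p
  truncation {n} j p = ⊆-interpolate ⊥ p ⊥⊆
    (≤-trans (≤-reflexive (∣⊥∣≡0 n)) z≤n) (m⊓n≤n j (card p))

-- A set with fewer than `j` points is kept whole; being total, the operation can be mapped over a
-- list of sets.
truncate : ℕ → Subset n → Subset n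
truncate j p = proj₁ (truncation j p)

truncate⊆ : ∀ j (p : Subset n) → truncate j p ⊆ p
truncate⊆ j p = proj₁ (proj₂ (proj₂ (truncation j p)))

card-truncate : ∀ j (p : Subset n) → card (truncate j p) ≡ j ⊓ card p
card-truncate j p = proj₂ (proj₂ (proj₂ (truncation j p)))

card-⋃ : ∀ {j} {ps : List (Subset n)} → All (λ p → card p ≤ j) ps →
         card (⋃ ps) ≤ length ps * j
card-⋃ {n} [] = ≤-reflexive (∣⊥∣≡0 n)
card-⋃ {ps = p ∷ ps} (∣p∣≤j ∷ rest) =
  ≤-trans (card-∪ p (⋃ ps)) (+-mono-≤ ∣p∣≤j (card-⋃ rest))

∈⇒⊆⋃ : ∀ {ps : List (Subset n)} → p ∈ ps → p ⊆ ⋃ ps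
∈⇒⊆⋃ {ps = p ∷ ps} (here refl) = p⊆p∪q (⋃ ps)
∈⇒⊆⋃ {ps = p ∷ ps} (there p∈ps) = q⊆p∪q p (⋃ ps) ∘ ∈⇒⊆⋃ p∈ps

⋃-least : ∀ {ps : List (Subset n)} → All (_⊆ q) ps → ⋃ ps ⊆ q
⋃-least {ps = []} [] x∈⊥ = contradiction x∈⊥ ∉⊥
⋃-least {ps = p ∷ ps} (p⊆q ∷ rest) x∈ with x∈p∪q⁻ p (⋃ ps) x∈
... | inj₁ x∈p = p⊆q x∈p
... | inj₂ x∈⋃ = ⋃-least rest x∈⋃

card-∩-≤ : ∀ (p r : Subset n) → (∀ {x} → x ∈ˢ p → x ∈ˢ r → x ∈ˢ q) → card (p ∩ r) ≤ card q
card-∩-≤ p r f = p⊆q⇒∣p∣≤∣q∣ λ x∈ →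
  let x∈p , x∈r = x∈p∩q⁻ p r x∈ in f x∈p x∈r

⊆∩ : ∀ {r : Subset n} → r ⊆ p → r ⊆ q → r ⊆ p ∩ q
⊆∩ r⊆p r⊆q x∈r = x∈p∩q⁺ (r⊆p x∈r , r⊆q x∈r)

∈⇒↭∷ : ∀ {A : Set} {x : A} {xs} → x ∈ xs → ∃[ ys ] xs ↭ x ∷ ys
∈⇒↭∷ {x = x} x∈xs with ys , zs , eq ← ∈-∃++ x∈xs =
  ys ++ zs , ↭-trans (↭-reflexive eq) (shift x ys zs)

-- Families of pairwise disjoint sets.

Disjoint : Subset n → Subset n → Set
Disjoint p q = ∀ x → x ∈ˢ p → x ∉ˢ q

Disjoint-sym : Disjoint p q → Disjoint q p
Disjoint-sym p#q x x∈q x∈p = p#q x x∈p x∈q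

-- By induction, the points of the first set are deleted from `u`; the later sets are disjoint from
-- it, so their intersections with `u` do not shrink.
disjoint-pigeonhole : ∀ {j} {ps : List (Subset n)} (u : Subset n) → AllPairs Disjoint ps →
  All (λ p → j ≤ card (u ∩ p)) ps → length ps * j ≤ card u
disjoint-pigeonhole u [] [] = z≤n
disjoint-pigeonhole {j = j} {p ∷ ps} u (p# ∷ disjoint) (j≤ ∷ js≤) = begin
  j + length ps * j               ≤⟨ +-mono-≤ j≤ (disjoint-pigeonhole (u ∩ ∁ p) disjoint
                                       (All.zipWith shrink (p# , js≤))) ⟩
  card (u ∩ p) + card (u ∩ ∁ p)   ≡⟨ card-split u p ⟨
  card u                          ∎
  where
  open ≤-Reasoning
  shrink : ∀ {q} → Disjoint p q × j ≤ card (u ∩ q) → j ≤ card ((u ∩ ∁ p) ∩ q)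
  shrink {q} (p#q , j≤) = ≤-trans j≤ (card-∩-≤ u q λ x∈u x∈q →
    x∈p∩q⁺ (x∈p∩q⁺ (x∈u , x∉p⇒x∈∁p (Disjoint-sym p#q _ x∈q)) , x∈q))

disjointKSubset : ∀ k (p : Subset n) → card p + k ≤ n →
  ∃[ B ] Disjoint p (proj₁ {B = λ B → card B ≡ k} B)
disjointKSubset {n} k p room =
  (truncate k (∁ p) , trans (card-truncate k (∁ p)) (m≤n⇒m⊓n≡m k≤∣∁p∣)) ,
  λ _ x∈p x∈B → x∈∁p⇒x∉p (truncate⊆ k (∁ p) x∈B) x∈p
  where
  k≤∣∁p∣ : k ≤ card (∁ p)
  k≤∣∁p∣ = subst (k ≤_) (sym (∣∁p∣≡n∸∣p∣ p))
             (m+n≤o⇒m≤o∸n k (subst (_≤ n) (+-comm (card p) k) room))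

-- A greedy choice: `p` accumulates the points already used, and each new set is taken from its
-- complement.
disjointKSubsets : ∀ k t (p : Subset n) → card p + k * t ≤ n →
  ∃[ Bs ] length Bs ≡ t × All (λ (B : KSubset n k) → Disjoint p (proj₁ B)) Bs
        × AllPairs (λ B C → Disjoint (proj₁ B) (proj₁ C)) Bs
disjointKSubsets k zero p _ = [] , refl , [] , []
disjointKSubsets {n} k (suc t) p room
  with (B , ∣B∣≡k) , p#B ← disjointKSubset k p
         (≤-trans (+-monoʳ-≤ (card p) (m≤m*n k (suc t))) room)
  with Bs , len , p∪B# , disjoint ← disjointKSubsets k t (p ∪ B) (let open ≤-Reasoning in begin
         card (p ∪ B) + k * t      ≤⟨ +-monoˡ-≤ (k * t) (card-∪ p B) ⟩
         card p + card B + k * t   ≡⟨ cong (λ c → card p + c + k * t) ∣B∣≡k ⟩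
         card p + k + k * t        ≡⟨ +-assoc (card p) k (k * t) ⟩
         card p + (k + k * t)      ≡⟨ cong (card p +_) (*-suc k t) ⟨
         card p + k * suc t        ≤⟨ room ⟩
         n                         ∎)
  = (B , ∣B∣≡k) ∷ Bs , cong suc len
  , p#B ∷ All.map (λ # x x∈p → # x (p⊆p∪q B x∈p)) p∪B#
  , All.map (λ # x x∈B → # x (q⊆p∪q p B x∈B)) p∪B# ∷ disjoint

-- A `k`-set nearly missing `p` and meeting every other given set.

-- One point of `p` outside `q` is collected for each `q`.
transversal : ∀ {qs : List (Subset n)} → All (λ q → ¬ p ⊆ q) qs →
  ∃[ r ] r ⊆ p × card r ≤ length qs × All (λ q → ¬ r ⊆ q) qs
transversal {n} [] = ⊥ , ⊥⊆ , ≤-reflexive (∣⊥∣≡0 n) , []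
transversal {p = p} (p⊈q ∷ p⊈qs)
  with x , x∈p , x∉q ← ⊈⇒∃ p⊈q
     | r , r⊆p , ∣r∣≤ , r⊈qs ← transversal {p = p} p⊈qs
  = ⁅ x ⁆ ∪ r
  , xr⊆p
  , ≤-trans (card-∪ ⁅ x ⁆ r) (+-mono-≤ (≤-reflexive (∣⁅x⁆∣≡1 x)) ∣r∣≤)
  , (λ r⊆q → x∉q (r⊆q (p⊆p∪q r (x∈⁅x⁆ x))))
    ∷ All.map (λ r⊈q xr⊆q → r⊈q (λ y∈r → xr⊆q (q⊆p∪q ⁅ x ⁆ r y∈r))) r⊈qs
  where
  xr⊆p : ⁅ x ⁆ ∪ r ⊆ p
  xr⊆p y∈ with x∈p∪q⁻ ⁅ x ⁆ r y∈
  ... | inj₁ y∈x with refl ← x∈⁅y⁆⇒x≡y x y∈x = x∈p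
  ... | inj₂ y∈r = r⊆p y∈r

-- The complement of a (k ∸ a)-subset of p that is contained in no member of qs.
separator : ∀ {qs : List (Subset n)} → a ≤ k → card p ≡ k →
  All (λ q → card q ≡ k) qs → All (λ q → ¬ p ⊆ q) qs → length qs ≤ k ∸ a →
  ∃[ d ] card (p ∩ d) ≤ a × All (λ q → a < card (q ∩ d)) qs
separator {n} {a} {k} {p} {qs} a≤k ∣p∣≡k ∣qs∣≡k p⊈qs len
  with r₀ , r₀⊆p , ∣r₀∣≤ , r₀⊈qs ← transversal {p = p} p⊈qs
  with r , r₀⊆r , r⊆p , ∣r∣ ← ⊆-interpolate r₀ p r₀⊆p (≤-trans ∣r₀∣≤ len)
         (subst (k ∸ a ≤_) (sym ∣p∣≡k) (m∸n≤m k a))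
  = ∁ r , +-cancelˡ-≤ (k ∸ a) _ _ p∩∁r , All.zipWith many (∣qs∣≡k , r₀⊈qs)
  where
  open ≤-Reasoning
  p∩∁r : k ∸ a + card (p ∩ ∁ r) ≤ k ∸ a + a
  p∩∁r = begin
    k ∸ a + card (p ∩ ∁ r)          ≡⟨ cong (_+ card (p ∩ ∁ r)) ∣r∣ ⟨
    card r + card (p ∩ ∁ r)         ≤⟨ +-monoˡ-≤ _ (p⊆q⇒∣p∣≤∣q∣ (⊆∩ {p = p} {r} r⊆p id)) ⟩
    card (p ∩ r) + card (p ∩ ∁ r)   ≡⟨ card-split p r ⟨
    card p                          ≡⟨ ∣p∣≡k ⟩
    k                               ≡⟨ m∸n+n≡m a≤k ⟨
    k ∸ a + a                       ∎
  many : ∀ {q} → card q ≡ k × ¬ (r₀ ⊆ q) → a < card (q ∩ ∁ r)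
  many {q} (∣q∣≡k , r₀⊈q) with x , x∈r₀ , x∉q ← ⊈⇒∃ r₀⊈q =
    -- The point `x` lies in `r` but not in `q`, so `q` has fewer than `k ∸ a` points in `r` and
    -- hence more than `a` outside it.
    ≰⇒> λ ∣q∩∁r∣≤a → <-irrefl refl (begin-strict
      k                               ≡⟨ ∣q∣≡k ⟨
      card q                          ≡⟨ card-split q r ⟩
      card (q ∩ r) + card (q ∩ ∁ r)   ≤⟨ +-monoʳ-≤ (card (q ∩ r)) ∣q∩∁r∣≤a ⟩
      card (q ∩ r) + a                <⟨ +-monoˡ-< a (p⊂q⇒∣p∣<∣q∣
                                           (p∩q⊆q q r , x , r₀⊆r x∈r₀ , x∉q ∘ proj₁ ∘ x∈p∩q⁻ q r)) ⟩
      card r + a                      ≡⟨ cong (_+ a) ∣r∣ ⟩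
      k ∸ a + a                       ≡⟨ m∸n+n≡m a≤k ⟩
      k                               ∎)

-- Take the union u of one (a + 1)-subset of q ∩ d for each q.  If u is itself a
-- member of qs, then the subsets chosen for the other members already suffice.
core : ∀ {qs : List (Subset n)} (d : Subset n) → a + 2 ≤ k → length qs * suc a ≤ k →
  All (λ q → card q ≡ k) qs → All (λ q → a < card (q ∩ d)) qs →
  ∃[ u ] u ⊆ d × All (λ q → a < card (u ∩ q)) qs ×
         (card u < k ⊎ card u ≡ k × u ∉ qs)
core {n} {a} {k} {qs} d a+2≤k len*≤k ∣qs∣≡k a<∣qs∩d∣ = result
  where
  open ≤-Reasoning
  G : Subset n → Subset n
  G q = truncate (suc a) (q ∩ d)
  U : List (Subset n) → Subset n
  U = ⋃ ∘ map G
  G⊆q : ∀ q → G q ⊆ q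
  G⊆q q = proj₁ ∘ x∈p∩q⁻ q d ∘ truncate⊆ (suc a) (q ∩ d)
  U⊆d : ∀ rs → U rs ⊆ d
  U⊆d rs = ⋃-least (All.map⁺ (All.universal
    (λ q {_} → proj₂ ∘ x∈p∩q⁻ q d ∘ truncate⊆ (suc a) (q ∩ d)) rs))
  ∣U∣≤ : ∀ rs → card (U rs) ≤ length rs * suc a
  ∣U∣≤ rs = subst (λ l → card (U rs) ≤ l * suc a) (length-map G rs)
    (card-⋃ (All.map⁺ (All.universal (λ q →
      ≤-trans (≤-reflexive (card-truncate (suc a) (q ∩ d))) (m⊓n≤m (suc a) _)) rs)))
  hit : ∀ {q rs} p → a < card (q ∩ d) → q ∈ rs → G q ⊆ p → a < card (U rs ∩ p)
  hit {q} {rs} p a<∣q∩d∣ q∈rs Gq⊆p = begin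
    suc a                          ≡⟨ m≤n⇒m⊓n≡m a<∣q∩d∣ ⟨
    suc a ⊓ card (q ∩ d)           ≡⟨ card-truncate (suc a) (q ∩ d) ⟨
    card (G q)                     ≤⟨ p⊆q⇒∣p∣≤∣q∣ (⊆∩ {p = U rs} {p} (∈⇒⊆⋃ (∈-map⁺ G q∈rs)) Gq⊆p) ⟩
    card (U rs ∩ p)                ∎
  hits : ∀ rs → All (λ q → a < card (q ∩ d)) rs → All (λ q → a < card (U rs ∩ q)) rs
  hits rs a<∣rs∩d∣ = All.tabulate λ {q} q∈rs → hit q (All.lookup a<∣rs∩d∣ q∈rs) q∈rs (G⊆q q)
  Result : Set
  Result = ∃[ u ] u ⊆ d × All (λ q → a < card (u ∩ q)) qs ×
           (card u < k ⊎ card u ≡ k × u ∉ qs)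
  drop-U : ∀ rs → qs ↭ U qs ∷ rs → Result
  -- Here `U qs` is the only member, so it has `k` points; but it was built from a single
  -- truncation, with at most `a + 1` points.
  drop-U [] perm = contradiction ∣qs∣≤ (<⇒≱ (begin-strict
      length qs * suc a    ≡⟨ cong (_* suc a) (↭-length perm) ⟩
      1 * suc a            ≡⟨ *-identityˡ (suc a) ⟩
      suc a                <⟨ ≤-reflexive (+-comm 2 a) ⟩
      a + 2                ≤⟨ a+2≤k ⟩
      k                    ∎))
    where
    ∣qs∣≤ : k ≤ length qs * suc a
    ∣qs∣≤ = subst (_≤ length qs * suc a) (All.head (All-resp-↭ perm ∣qs∣≡k)) (∣U∣≤ qs)
  drop-U rs@(r ∷ rs′) perm =
    U rs , U⊆d rs ,
    All-resp-↭ (↭-sym perm)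
      -- The dropped member `U qs` is still met often enough, since `G r` lies in both `U rs` and
      -- `U qs`.
      (hit {r} {rs} (U qs) (All.head a<∣rs∩d∣) (here refl)
           (∈⇒⊆⋃ (∈-map⁺ G (∈-resp-↭ (↭-sym perm) (there (here refl)))))
       ∷ hits rs a<∣rs∩d∣) ,
    inj₁ (begin-strict
      card (U rs)               ≤⟨ ∣U∣≤ rs ⟩
      length rs * suc a         <⟨ m<n+m (length rs * suc a) (s≤s z≤n) ⟩
      suc (length rs) * suc a   ≡⟨ cong (_* suc a) (↭-length perm) ⟨
      length qs * suc a         ≤⟨ len*≤k ⟩
      k                         ∎)
    where a<∣rs∩d∣ = All.tail (All-resp-↭ perm a<∣qs∩d∣)
  result : Result
  result with any? (Vec.≡-dec Bool._≟_ (U qs)) qs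
  ... | yes U∈qs with rs , perm ← ∈⇒↭∷ U∈qs = drop-U rs perm
  ... | no  U∉qs with m≤n⇒m<n∨m≡n (≤-trans (∣U∣≤ qs) len*≤k)
  ... | inj₁ ∣U∣<k = U qs , U⊆d qs , hits qs a<∣qs∩d∣ , inj₁ ∣U∣<k
  ... | inj₂ ∣U∣≡k = U qs , U⊆d qs , hits qs a<∣qs∩d∣ , inj₂ (∣U∣≡k , U∉qs)

-- Inside the set `d` of `separator`, `core` finds a set meeting every `q` in more than `a` points.
-- If it is too small it is padded outside `p`, which leaves its intersection with `p` unchanged.
isolating-set : ∀ {qs : List (Subset n)} → a + 2 ≤ k →
  length qs * suc a ≤ k → length qs ≤ k ∸ a → k * (length qs + 2) ≤ n →
  card p ≡ k → All (λ q → card q ≡ k) qs → All (p ≢_) qs →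
  ∃[ u ] card u ≡ k × card (u ∩ p) ≤ a × All (λ q → a < card (u ∩ q)) qs × u ∉ qs
isolating-set {n} {a} {k} {p} {qs} a+2≤k len*≤k len≤ room ∣p∣≡k ∣qs∣≡k p≢qs
  with d , ∣p∩d∣≤a , a<∣qs∩d∣ ← separator {a = a} {p = p} (m+n≤o⇒m≤o a a+2≤k) ∣p∣≡k ∣qs∣≡k
         (All.zipWith (λ { (∣q∣≡k , p≢q) p⊆q →
            p≢q (⊆∧card≥⇒≡ p⊆q (≤-reflexive (trans ∣q∣≡k (sym ∣p∣≡k)))) }) (∣qs∣≡k , p≢qs))
         len≤
  with core d a+2≤k len*≤k ∣qs∣≡k a<∣qs∩d∣
... | u , u⊆d , a<∣u∩qs∣ , inj₂ (∣u∣≡k , u∉qs) =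
  u , ∣u∣≡k ,
  ≤-trans (card-∩-≤ u p (λ x∈u x∈p → x∈p∩q⁺ (x∈p , u⊆d x∈u))) ∣p∩d∣≤a ,
  a<∣u∩qs∣ , u∉qs
... | u , u⊆d , a<∣u∩qs∣ , inj₁ ∣u∣<k = extend
  where
  open ≤-Reasoning
  Result : Set
  Result = ∃[ u ] card u ≡ k × card (u ∩ p) ≤ a × All (λ q → a < card (u ∩ q)) qs × u ∉ qs
  l = length qs
  0<k : 0 < k
  0<k = ≤-trans (s≤s z≤n) ∣u∣<k
  ∣⋃∣<n : card (⋃ (p ∷ qs)) < n
  ∣⋃∣<n = begin-strict
    card (⋃ (p ∷ qs))    ≤⟨ card-⋃ {ps = p ∷ qs} (All.map ≤-reflexive (∣p∣≡k ∷ ∣qs∣≡k)) ⟩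
    suc l * k            <⟨ m<n+m (suc l * k) 0<k ⟩
    (2 + l) * k          ≡⟨ cong (_* k) (+-comm 2 l) ⟩
    (l + 2) * k          ≡⟨ *-comm (l + 2) k ⟩
    k * (l + 2)          ≤⟨ room ⟩
    n                    ∎
  k≤∣∁p∣ : k ≤ card (∁ p)
  k≤∣∁p∣ = begin
    k            ≤⟨ m+n≤o⇒m≤o∸n k (begin
      k + k              ≡⟨ cong (k +_) (+-identityʳ k) ⟨
      2 * k              ≡⟨ *-comm 2 k ⟩
      k * 2              ≤⟨ *-monoʳ-≤ k (m≤n+m 2 l) ⟩
      k * (l + 2)        ≤⟨ room ⟩
      n                  ∎) ⟩
    n ∸ k        ≡⟨ cong (n ∸_) ∣p∣≡k ⟨
    n ∸ card p   ≡⟨ ∣∁p∣≡n∸∣p∣ p ⟨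
    card (∁ p)   ∎
  extend : Result
  extend
    -- The `l + 1` given sets cover fewer than `n` points. A point `x` outside all of them keeps the
    -- padded set from being a member of `qs`.
    with x , x∉⋃ ← card<n⇒∃∉ (⋃ (p ∷ qs)) ∣⋃∣<n
    with w , ux⊆w , w⊆ , ∣w∣≡k ← ⊆-interpolate (u ∪ ⁅ x ⁆) ((u ∪ ⁅ x ⁆) ∪ ∁ p)
           (p⊆p∪q (∁ p))
           (≤-trans (card-∪ u ⁅ x ⁆) (≤-trans (≤-reflexive
             (trans (cong (card u +_) (∣⁅x⁆∣≡1 x)) (+-comm (card u) 1))) ∣u∣<k))
           (≤-trans k≤∣∁p∣ (∣q∣≤∣p∪q∣ (u ∪ ⁅ x ⁆) (∁ p)))
    = w , ∣w∣≡k
    , ≤-trans (card-∩-≤ w p (λ y∈w y∈p → x∈p∩q⁺ (y∈p , u⊆d (in-u y∈w y∈p)))) ∣p∩d∣≤a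
    , All.map (λ {q} a<∣u∩q∣ → ≤-trans a<∣u∩q∣ (card-∩-≤-∩ q)) a<∣u∩qs∣
    , λ w∈qs → x∉⋃ (∈⇒⊆⋃ {ps = p ∷ qs} (there w∈qs) (ux⊆w (q⊆p∪q u ⁅ x ⁆ (x∈⁅x⁆ x))))
    where
    in-u : ∀ {y} → y ∈ˢ w → y ∈ˢ p → y ∈ˢ u
    in-u y∈w y∈p with x∈p∪q⁻ (u ∪ ⁅ x ⁆) (∁ p) (w⊆ y∈w)
    ... | inj₂ y∈∁p = contradiction y∈p (x∈∁p⇒x∉p y∈∁p)
    ... | inj₁ y∈ux with x∈p∪q⁻ u ⁅ x ⁆ y∈ux
    ... | inj₁ y∈u = y∈u
    ... | inj₂ y∈x with refl ← x∈⁅y⁆⇒x≡y x y∈x =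
      contradiction (∈⇒⊆⋃ {ps = p ∷ qs} (here refl) y∈p) x∉⋃
    card-∩-≤-∩ : ∀ q → card (u ∩ q) ≤ card (w ∩ q)
    card-∩-≤-∩ q = card-∩-≤ u q λ y∈u y∈q → x∈p∩q⁺ (ux⊆w (p⊆p∪q ⁅ x ⁆ y∈u) , y∈q)

-- Zero forcing and zero blocking in an arbitrary graph.

module _ (G : Graph) where
  open Graph G
  open ZeroForcing G renaming (∁ to ∁ᵛ)
  open import Data.List.Membership.DecPropositional _≟_ using (_∈?_)

  -- Duplicate-free lists with the same members are permutations of each other.
  size-of-unique : ∀ {W vs} → Unique vs → (∀ v → v ∈ vs ⇔ v ∈ᵛ W) → size W ≡ length vs
  size-of-unique {W} vs! vs≡W = ↭-length (∼bag⇒↭ (unique∧set⇒bag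
    (Unique.filter⁺ (Bool.T? ∘ W) unique) vs!
    (λ {v} → mk⇔ (from (vs≡W v) ∘ proj₂ ∘ ∈-filter⁻ (Bool.T? ∘ W) {xs = vertices})
                 (∈-filter⁺ (Bool.T? ∘ W) (complete v) ∘ to (vs≡W v)))))

  ∈∁⇔∉ : ∀ W v → v ∈ᵛ ∁ᵛ W ⇔ v ∉ᵛ W
  ∈∁⇔∉ W v with W v
  ... | true  = mk⇔ (λ ()) (λ ¬t → contradiction _ ¬t)
  ... | false = mk⇔ (λ _ ()) _

  -- The colouring is tracked through the list of its white vertices, and a force deletes the head
  -- of that list.
  force-head : ∀ {u w ws Z} → All (w ≢_) ws → (∀ v → v ∈ᵛ Z ⇔ v ∉ w ∷ ws) →
    u ∉ w ∷ ws → Adj u w → All (λ v → ¬ Adj u v) ws →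
    ∃[ Z′ ] Z ⟶ Z′ × (∀ v → v ∈ᵛ Z′ ⇔ v ∉ ws)
  force-head {u} {w} {ws} {Z} w≢ws black u∉ u~w u≁ws = Z′ , force , black′
    where
    Z′ : VertexSet
    Z′ v = Z v ∨ ⌊ v ≟ w ⌋
    recolour : ∀ v → v ∈ᵛ Z′ ⇔ (v ∈ᵛ Z ⊎ v ≡ w)
    recolour v = mk⇔ (Sum.map₂ toWitness ∘ to Bool.T-∨) (from Bool.T-∨ ∘ Sum.map₂ fromWitness)
    only-w : ∀ v → Adj u v → v ∉ᵛ Z → v ≡ w
    only-w v u~v v∉Z with decidable-stable (v ∈? w ∷ ws) (v∉Z ∘ from (black v))
    ... | here v≡w    = v≡w
    ... | there v∈ws = contradiction u~v (All.lookup u≁ws v∈ws)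
    force : Z ⟶ Z′
    force = record
      { u = u ; v = w
      ; u-black  = from (black u) u∉
      ; v-white  = λ w∈Z → to (black w) w∈Z (here refl)
      ; u-adj-v  = u~w
      ; only-v   = only-w
      ; recolour = recolour
      }
    black′ : ∀ v → v ∈ᵛ Z′ ⇔ v ∉ ws
    black′ v = mk⇔ sound (from (recolour v) ∘ complete′)
      where
      sound : v ∈ᵛ Z′ → v ∉ ws
      sound v∈Z′ v∈ws with to (recolour v) v∈Z′
      ... | inj₁ v∈Z = to (black v) v∈Z (there v∈ws)
      ... | inj₂ v≡w = All.lookup w≢ws v∈ws (sym v≡w)
      complete′ : v ∉ ws → v ∈ᵛ Z ⊎ v ≡ w
      complete′ v∉ws with v ≟ w
      ... | yes v≡w = inj₂ v≡w
      ... | no  v≢w = inj₁ (from (black v)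
                        λ { (here v≡w) → v≢w v≡w ; (there v∈ws) → v∉ws v∈ws })

  -- The white vertices are forced in list order. The length condition counts only the vertices
  -- behind the head, so it holds at each step for lists of length at most `m`.
  forcing-by-isolation : ∀ {m} →
    (∀ {w ws} → All (w ≢_) ws → length ws < m →
      ∃[ u ] u ∉ w ∷ ws × Adj u w × All (λ v → ¬ Adj u v) ws) →
    ∀ {ws Z} → Unique ws → length ws ≤ m → (∀ v → v ∈ᵛ Z ⇔ v ∉ ws) → IsZeroForcingSet Z
  forcing-by-isolation isolate {[]} {Z} _ _ black = Z , ε , λ v → from (black v) λ ()
  forcing-by-isolation isolate {w ∷ ws} (w≢ws ∷ ws!) len black
    with u , u∉ , u~w , u≁ws ← isolate w≢ws len
    with Z′ , force , black′ ← force-head w≢ws black u∉ u~w u≁ws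
    with Z″ , forces , all-black ← forcing-by-isolation isolate ws! (<⇒≤ len) black′
    = Z″ , force ◅ forces , all-black

  blocking-size≥ : ∀ {m} →
    (∀ {w ws} → All (w ≢_) ws → length ws < m →
      ∃[ u ] u ∉ w ∷ ws × Adj u w × All (λ v → ¬ Adj u v) ws) →
    ∀ W → IsZeroBlockingSet W → m < size W
  blocking-size≥ isolate W blocking = ≰⇒> λ size≤m → blocking
    (forcing-by-isolation isolate {filter (Bool.T? ∘ W) vertices}
      (Unique.filter⁺ (Bool.T? ∘ W) unique) size≤m λ v → mk⇔
        (λ v∈∁W → to (∈∁⇔∉ W v) v∈∁W ∘ proj₂ ∘ ∈-filter⁻ (Bool.T? ∘ W) {xs = vertices})
        (λ v∉ → from (∈∁⇔∉ W v) (v∉ ∘ ∈-filter⁺ (Bool.T? ∘ W) (complete v))))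

  -- A run of the process either is empty, leaving `w` white, or starts with a force, which
  -- `stalled` excludes.
  stalled⇒blocking : ∀ {W w} → w ∈ᵛ W →
    (∀ {u v} → u ∉ᵛ W → v ∈ᵛ W → Adj u v → ¬ (∀ w → Adj u w → w ∈ᵛ W → w ≡ v)) →
    IsZeroBlockingSet W
  stalled⇒blocking {W} {w} w∈W stalled (_ , ε , all-black) = to (∈∁⇔∉ W w) (all-black w) w∈W
  stalled⇒blocking {W} w∈W stalled (_ , force ◅ _ , _) = stalled
    (to (∈∁⇔∉ W u) u-black)
    (decidable-stable (Bool.T? (W v)) (v-white ∘ from (∈∁⇔∉ W v)))
    u-adj-v
    (λ x u~x x∈W → only-v x u~x λ x∈∁W → to (∈∁⇔∉ W x) x∈∁W x∈W)
    where open _⟶_ force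

-- Application to the generalized Kneser graph.

card-∩<⇒≢ : card (p ∩ q) < card p → p ≢ q
card-∩<⇒≢ {p = p} ∣p∩p∣<∣p∣ refl = <-irrefl (cong card (∩-idem p)) ∣p∩p∣<∣p∣

isolating-vertex : ∀ {w : KSubset n k} {ws} → a + 2 ≤ k →
  length ws * suc a ≤ k → length ws ≤ k ∸ a → k * (length ws + 2) ≤ n →
  All (w ≢_) ws →
  ∃[ u ] u ∉ w ∷ ws × Graph.Adj (K n k a) u w × All (λ v → ¬ Graph.Adj (K n k a) u v) ws
isolating-vertex {n} {k} {a} {w} {ws} a+2≤k len*≤k len≤ room w≢ws
  with u , ∣u∣≡k , ∣u∩w∣≤a , a<∣u∩ws∣ , u∉ws ←
    isolating-set {p = proj₁ w} {qs = map proj₁ ws} a+2≤k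
      (subst (λ l → l * suc a ≤ k) (sym (length-map proj₁ ws)) len*≤k)
      (subst (_≤ k ∸ a) (sym (length-map proj₁ ws)) len≤)
      (subst (λ l → k * (l + 2) ≤ n) (sym (length-map proj₁ ws)) room)
      (proj₂ w) (All.map⁺ (All.universal proj₂ ws))
      (All.map⁺ (All.map (λ w≢v → w≢v ∘ KSubset-≡) w≢ws))
  -- Adjacency also demands distinctness, which follows from `u` and `w` sharing at most `a < k`
  -- points.
  = let u≢w = card-∩<⇒≢ (≤-<-trans ∣u∩w∣≤a (subst (a <_) (sym ∣u∣≡k) a<k)) ∘ cong proj₁ in
    (u , ∣u∣≡k)
  , (λ { (here u≡w) → u≢w u≡w ; (there u∈ws) → u∉ws (∈-map⁺ proj₁ u∈ws) })
  , (u≢w , ∣u∩w∣≤a)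
  , All.map (λ a<∣u∩v∣ (_ , ∣u∩v∣≤a) → <⇒≱ a<∣u∩v∣ ∣u∩v∣≤a) (All.map⁻ a<∣u∩ws∣)
  where
  a<k : a < k
  a<k = ≤-trans (≤-trans (n≤1+n _) (≤-reflexive (+-comm 2 a))) a+2≤k

-- The size `suc k` makes every block nonempty, and a nonempty set is not disjoint from itself.
disjoint⇒unique : ∀ {Bs : List (KSubset n (suc k))} →
  AllPairs (λ B C → Disjoint (proj₁ B) (proj₁ C)) Bs → Unique Bs
disjoint⇒unique = AllPairs.map λ { {B , ∣B∣} B#B refl →
  let x , x∈B = card>0⇒Nonempty {p = B} (subst (0 <_) (sym ∣B∣) (s≤s z≤n)) in B#B x x∈B x∈B }

-- If a black `u` had just one white neighbour, it would meet each of the other `l` blocks in at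
-- least `a + 1` points, more than its `suc k` points allow.
disjoint⇒blocking : ∀ {l} {Bs : List (KSubset n (suc k))} → length Bs ≡ suc l → suc k < l * suc a →
  AllPairs (λ B C → Disjoint (proj₁ B) (proj₁ C)) Bs →
  ∃[ W ] ZeroForcing.IsZeroBlockingSet (K n (suc k) a) W
       × ZeroForcing.size (K n (suc k) a) W ≡ suc l
disjoint⇒blocking {n} {k} {a} {l} {Bs@(B₀ ∷ _)} len k<l* disjoint =
  W , stalled⇒blocking G {W} {B₀} (fromWitness (here refl)) stalled ,
  trans (size-of-unique G {W} Bs! (λ B → mk⇔ fromWitness toWitness)) len
  where
  G = K n (suc k) a
  open Graph G using (Vertex; Adj)
  open import Data.List.Membership.DecPropositional (_≟ᴷ_ {n} {suc k}) using (_∈?_)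
  W : Vertex → Bool
  W B = ⌊ B ∈? Bs ⌋
  Bs! = disjoint⇒unique disjoint
  stalled : ∀ {u v} → ¬ T (W u) → T (W v) → Adj u v → ¬ (∀ w → Adj u w → T (W w) → w ≡ v)
  stalled {u} {v} u∉W v∈W _ only-v with rest , perm ← ∈⇒↭∷ (toWitness {a? = v ∈? Bs} v∈W)
    with v#rest ∷ disjoint′ ← ↭ₛ.AllPairs-resp-↭ (setoid Vertex) Disjoint-sym (resp₂ _) (↭⇒↭ₛ perm) disjoint
    with v≢rest ∷ _ ← disjoint⇒unique (v#rest ∷ disjoint′)
    = <⇒≱ k<l* (begin
      l * suc a                            ≡⟨ cong (_* suc a) (suc-injective (trans (sym len) (↭-length perm))) ⟩
      length rest * suc a                  ≡⟨ cong (_* suc a) (length-map proj₁ rest) ⟨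
      length (map proj₁ rest) * suc a      ≤⟨ disjoint-pigeonhole (proj₁ u) (AllPairs.map⁺ disjoint′)
                                                -- A block `w` sharing at most `a` points with `u`
                                                -- is adjacent to `u`, since `u` is black and `w`
                                                -- white; it would then be `v`, which occurs only
                                                -- once.
                                                (All.map⁺ (All.tabulate λ {w} w∈rest → ≰⇒> λ ∣u∩w∣≤a →
                                                  let w∈W = fromWitness (∈-resp-↭ (↭-sym perm) (there w∈rest)) in
                                                  All.lookup v≢rest w∈rest
                                                    (sym (only-v w ((λ { refl → u∉W w∈W }) , ∣u∩w∣≤a) w∈W)))) ⟩
      card (proj₁ u)                       ≡⟨ proj₂ u ⟩
      suc k                                ∎)
    where open ≤-Reasoning

theorem9 : (n k a : ℕ) → n ≥ k → a < k →
    n ≥ k * (⌈ (k ∸ a) / suc a ⌉ + 2) → a + 2 ≤ k →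
    IsZeroBlockingNumber (K n k a) (⌈ (k ∸ a) / suc a ⌉ + 2)
theorem9 n k@(suc _) a _ a<k room a+2≤k = subst (IsZeroBlockingNumber (K n k a)) (+-comm 2 s)
  ( disjoint⇒blocking lenBs k<[1+s]* disjoint
  -- The bound is used with `m` equal to `s + 1`: at most `s` white vertices remain beside the one
  -- to be forced, and `s + 1 < size W` is the required inequality.
  , blocking-size≥ (K n k a) λ { {w} {ws} w≢ws (s≤s len≤s) → isolating-vertex a+2≤k
      (≤-trans (*-monoˡ-≤ (suc a) len≤s) s*≤k)
      (≤-trans len≤s s≤k∸a)
      (≤-trans (*-monoʳ-≤ k (+-monoˡ-≤ 2 len≤s)) room)
      w≢ws } )
  where
  open ≤-Reasoning
  s = ⌈ (k ∸ a) / suc a ⌉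
  k∸a≤s* : k ∸ a ≤ s * suc a
  k∸a≤s* = proj₁ (⌈/⌉-bounds (k ∸ a) a)
  s*≤k∸a+a : s * suc a ≤ k ∸ a + a
  s*≤k∸a+a = proj₂ (⌈/⌉-bounds (k ∸ a) a)
  s*≤k : s * suc a ≤ k
  s*≤k = subst (s * suc a ≤_) (m∸n+n≡m (<⇒≤ a<k)) s*≤k∸a+a
  -- As `k ∸ a` is positive, `a` is at most `(k ∸ a) * a`, and the factor `suc a` then cancels.
  s≤k∸a : s ≤ k ∸ a
  s≤k∸a = *-cancelʳ-≤ s (k ∸ a) (suc a) (begin
    s * suc a                ≤⟨ s*≤k∸a+a ⟩
    k ∸ a + a                ≡⟨ cong (k ∸ a +_) (*-identityˡ a) ⟨
    k ∸ a + 1 * a            ≤⟨ +-monoʳ-≤ (k ∸ a) (*-monoˡ-≤ a (m<n⇒0<n∸m a<k)) ⟩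
    k ∸ a + (k ∸ a) * a      ≡⟨ *-suc (k ∸ a) a ⟨
    (k ∸ a) * suc a          ∎)
  k<[1+s]* : k < suc s * suc a
  k<[1+s]* = begin-strict
    k                    ≡⟨ m∸n+n≡m (<⇒≤ a<k) ⟨
    k ∸ a + a            <⟨ +-monoʳ-< (k ∸ a) (n<1+n a) ⟩
    k ∸ a + suc a        ≤⟨ +-monoˡ-≤ (suc a) k∸a≤s* ⟩
    s * suc a + suc a    ≡⟨ +-comm (s * suc a) (suc a) ⟩
    suc s * suc a        ∎
  blocks = disjointKSubsets {n} k (2 + s) ⊥
    (subst (λ c → c + k * (2 + s) ≤ n) (sym (∣⊥∣≡0 n)) (subst (λ t → k * t ≤ n) (+-comm s 2) room))
  lenBs = proj₁ (proj₂ blocks)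
  disjoint = proj₂ (proj₂ (proj₂ blocks))
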